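{- For any connected graphs $G$ and $H$, $\dim_s(G\Box H)\ge\dim_s(G)\,\dim_s(H)$.
   Context: All graphs are finite and simple. For a connected graph $G$, $I_G[u,v]$ is the set of vertices on some shortest $u$–$v$ path. A vertex $w$ strongly resolves $u,v$ if $v\in I_G[u,w]$ or $u\in I_G[v,w]$. A strong resolving set is a set $S\subseteq V(G)$ such that every pair of vertices is strongly resolved by some vertex of $S$; $\dim_s(G)$ is the minimum cardinality of a strong resolving set. $G\Box H$ is the Cartesian product: vertex set $V(G)\times V(H)$, $(a,b)\sim(c,d)$ iff ($a=c$ and $bd\in E(H)$) or ($b=d$ and $ac\in E(G)$). -}

module Defs where

open import Level using (0ℓ)
open import Data.Nat using (ℕ; zero; suc; _+_; _*_; _<_; _≤_)
open import Data.Fin using (Fin; remQuot)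
open import Data.Fin.Subset using (Subset; _∈_; ∣_∣)
open import Data.Product using (Σ; ∃; _×_; _,_; proj₁; proj₂)
open import Data.Sum using (_⊎_)
open import Relation.Nullary using (¬_)
open import Relation.Binary.PropositionalEquality using (_≡_)

record Graph : Set₁ where
  field
    n     : ℕ
    Adj   : Fin n → Fin n → Set
    sym   : ∀ {u v} → Adj u v → Adj v u
    irrefl : ∀ {u} → ¬ Adj u u
open Graph public

V : Graph → Set
V G = Fin (n G)

data Walk (G : Graph) : V G → V G → ℕ → Set where
  here : ∀ {u} → Walk G u u zero
  step : ∀ {u v w k} → Adj G u v → Walk G v w k → Walk G u w (suc k)

Connected : Graph → Set
Connected G = ∀ (u v : V G) → ∃ λ k → Walk G u v k

Dist : (G : Graph) → V G → V G → ℕ → Set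
Dist G u v k = Walk G u v k × (∀ m → m < k → ¬ Walk G u v m)

-- w ∈ I_G[u,v]: w lies on some shortest u–v path, i.e. there is a u–v walk of
-- length d(u,v) (necessarily a path) passing through w.
InInterval : (G : Graph) → V G → V G → V G → Set
InInterval G u v w =
  Σ ℕ λ a → Σ ℕ λ b → Walk G u w a × Walk G w v b × Dist G u v (a + b)

StronglyResolves : (G : Graph) → V G → V G → V G → Set
StronglyResolves G w u v = InInterval G u w v ⊎ InInterval G v w u

StrongResolvingSet : (G : Graph) → Subset (n G) → Set
StrongResolvingSet G S =
  ∀ (u v : V G) → ¬ (u ≡ v) → ∃ λ w → w ∈ S × StronglyResolves G w u v

IsStrongMetricDim : (G : Graph) → ℕ → Set
IsStrongMetricDim G k =
  (∃ λ S → StrongResolvingSet G S × ∣ S ∣ ≡ k)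
  × (∀ S → StrongResolvingSet G S → k ≤ ∣ S ∣)

□-Adj : (G H : Graph) → Fin (n G * n H) → Fin (n G * n H) → Set
□-Adj G H x y =
  let p = remQuot {n G} (n H) x ; q = remQuot {n G} (n H) y in
  (proj₁ p ≡ proj₁ q × Adj H (proj₂ p) (proj₂ q))
  ⊎ (proj₂ p ≡ proj₂ q × Adj G (proj₁ p) (proj₁ q))

_□_ : Graph → Graph → Graph
G □ H = record
  { n = n G * n H
  ; Adj = □-Adj G H
  ; sym = λ { (Data.Sum.inj₁ (e , a)) → Data.Sum.inj₁ (Relation.Binary.PropositionalEquality.sym e , Graph.sym H a)
            ; (Data.Sum.inj₂ (e , a)) → Data.Sum.inj₂ (Relation.Binary.PropositionalEquality.sym e , Graph.sym G a) }
  ; irrefl = λ { (Data.Sum.inj₁ (_ , a)) → Graph.irrefl H a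
               ; (Data.Sum.inj₂ (_ , a)) → Graph.irrefl G a }
  }

{-# OPTIONS --safe #-}

-- Call u, v mutually maximally distant if neither can be replaced by one of
-- its neighbours so as to increase d(u,v).  Since every geodesic extends to one
-- between such a pair, strong resolving sets are exactly the vertex covers of
-- the mutually-maximally-distant relation, and in a Cartesian product two
-- vertices are mutually maximally distant as soon as both coordinates are.
-- It remains to show τ(R × T) ≥ τ(R) τ(T) for vertex covers of a direct product.
-- Let C cover R × T, let D be a minimum cover of R, and for x in T put
-- X = { u : (u,x) ∈ C } and W = { u ∉ X : N(u) ⊆ X }.  Then
-- (D ∖ W) ∪ (X ∖ D) again covers R, so |D ∩ (X ∪ W)| ≤ |X| by minimality of D.
-- On the other hand, for every d ∈ D the x with d ∈ X ∪ W form a cover of T.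
-- Double counting the pairs (d,x) gives the bound.
module Submission where

open import Defs
open import Data.Bool using (true; false; if_then_else_)
open import Data.Empty using (⊥-elim)
open import Data.Fin using (Fin; zero; suc; combine; remQuot; _↑ˡ_; _↑ʳ_)
open import Data.Fin.Properties
  using (all?; sequence; remQuot-combine; combine-remQuot; combine-injectiveˡ)
  renaming (_≟_ to _≟ᶠ_)
open import Data.Fin.Subset using (Subset; _∈_; ∣_∣)
open import Data.Fin.Subset.Properties using (_∈?_)
open import Data.Nat using (ℕ; zero; suc; _+_; _*_; _≤_; _<_; z≤n; s≤s; _≤?_; _⊔_)
open import Data.Nat.Induction using (<-rec)
open import Data.Nat.Properties
open import Data.Product using (∃; _×_; _,_; proj₁; proj₂)
open import Data.Sum using (_⊎_; inj₁; inj₂)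
open import Data.Vec using ([]; _∷_; tabulate)
open import Data.Vec.Properties using (lookup∘tabulate; lookup⇒[]=; []=⇒lookup)
open import Effect.Monad using (RawMonad)
open import Function using (_∘_)
open import Relation.Binary.PropositionalEquality
  using (_≡_; _≢_; refl; cong; subst; subst₂)
  renaming (sym to ≡-sym; trans to ≡-trans)
open import Relation.Nullary using (¬_; Dec; yes; no; does; contradiction)
open import Relation.Nullary.Decidable
  using (decidable-stable; ¬¬-excluded-middle; ¬?; _×-dec_; _⊎-dec_; _→-dec_; dec-true)
open import Relation.Nullary.Negation using (¬¬-Monad; ¬¬-map)
open import Algebra.Properties.CommutativeMonoid.Sum +-0-commutativeMonoid
  using (sum; ∑-distrib-+; ∑-comm)
open import Algebra.Properties.Semiring.Sum +-*-semiring using (*-distribʳ-sum)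

private variable
  m k : ℕ
  P Q A : Set

-- Double negation and finite bounds

¬¬-∀Fin : {P : Fin k → Set} → (∀ i → ¬ ¬ P i) → ¬ ¬ (∀ i → P i)
¬¬-∀Fin = sequence (RawMonad.rawApplicative ¬¬-Monad)

-- Applied to walk lengths, this supplies a distance although adjacency need not be decidable.
¬¬-least : (P : ℕ → Set) → ∀ k → P k → ¬ ¬ (∃ λ l → P l × (∀ j → j < l → ¬ P j))
¬¬-least P k pk none = <-rec (λ k → ¬ P k) (λ _ below pk → none (_ , pk , λ j j<k → below j<k)) k pk

Fin-bounded : (f : Fin k → ℕ) → ∃ λ b → ∀ i → f i ≤ b
Fin-bounded {zero} f = 0 , λ ()
Fin-bounded {suc n} f with Fin-bounded (f ∘ suc)
... | b , f≤b = f zero ⊔ b , λ where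
  zero    → m≤m⊔n (f zero) b
  (suc i) → ≤-trans (f≤b i) (m≤n⊔m (f zero) b)

-- Indicator sums

ind : Dec P → ℕ
ind P? = if does P? then 1 else 0

ind-mono : (P? : Dec P) (Q? : Dec Q) → (P → Q) → ind P? ≤ ind Q?
ind-mono (no _)  _       _   = z≤n
ind-mono (yes _) (yes _) _   = ≤-refl
ind-mono (yes p) (no ¬q) P⇒Q = contradiction (P⇒Q p) ¬q

sum-mono-≤ : {f g : Fin k → ℕ} → (∀ i → f i ≤ g i) → sum f ≤ sum g
sum-mono-≤ {zero}  f≤g = z≤n
sum-mono-≤ {suc n} f≤g = +-mono-≤ (f≤g zero) (sum-mono-≤ (f≤g ∘ suc))

sum-+ : ∀ m {n} (f : Fin (m + n) → ℕ) →
        sum f ≡ sum (f ∘ (_↑ˡ n)) + sum (f ∘ (m ↑ʳ_))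
sum-+ zero    f = refl
sum-+ (suc m) f = ≡-trans (cong (f zero +_) (sum-+ m (f ∘ suc))) (≡-sym (+-assoc (f zero) _ _))

sum-combine : ∀ m {n} (f : Fin (m * n) → ℕ) →
              sum f ≡ sum {m} (λ i → sum (λ j → f (combine i j)))
sum-combine zero        f = refl
sum-combine (suc m) {n} f =
  ≡-trans (sum-+ n f) (cong (sum (f ∘ (_↑ˡ m * n)) +_) (sum-combine m (f ∘ (n ↑ʳ_))))

∣p∣≡sum : (p : Subset k) → ∣ p ∣ ≡ sum (λ i → ind (i ∈? p))
∣p∣≡sum []          = refl
∣p∣≡sum (true ∷ p)  = cong suc (∣p∣≡sum p)
∣p∣≡sum (false ∷ p) = ∣p∣≡sum p

comprehension : {P : Fin k → Set} → (∀ i → Dec (P i)) → Subset k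
comprehension P? = tabulate (does ∘ P?)

module _ {P : Fin k → Set} (P? : ∀ i → Dec (P i)) where

  ∈-comprehension⁺ : ∀ {i} → P i → i ∈ comprehension P?
  ∈-comprehension⁺ {i} p =
    lookup⇒[]= i _ (≡-trans (lookup∘tabulate (does ∘ P?) i) (dec-true (P? i) p))

  ∈-comprehension⁻ : ∀ {i} → i ∈ comprehension P? → P i
  ∈-comprehension⁻ {i} i∈ with P? i | ≡-trans (≡-sym (lookup∘tabulate (does ∘ P?) i)) ([]=⇒lookup i∈)
  ... | yes p | _ = p

  ∣comprehension∣≤sum : ∣ comprehension P? ∣ ≤ sum (ind ∘ P?)
  ∣comprehension∣≤sum = ≤-trans (≤-reflexive (∣p∣≡sum (comprehension P?)))
    (sum-mono-≤ λ i → ind-mono (i ∈? comprehension P?) (P? i) ∈-comprehension⁻)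

-- Vertex covers of direct products

Cover : (Fin k → Fin k → Set) → Subset k → Set
Cover R S = ∀ u v → R u v → u ∈ S ⊎ v ∈ S

-- Summed over all vertices this reads |D ∩ (X ∪ W)| + |E| ≤ |X| + |D|, where E is the modified
-- cover decided by `E?`; pointwise it is a truth table.
exchange-≤ : (D? : Dec P) (X? : Dec Q) (W? : Dec A) → (A → ¬ Q) →
  ind (D? ×-dec (X? ⊎-dec W?)) + ind ((D? ×-dec ¬? W?) ⊎-dec (¬? D? ×-dec X?)) ≤ ind X? + ind D?
exchange-≤ (yes _) (yes q) (yes w) W⇒¬X = contradiction q (W⇒¬X w)
exchange-≤ (yes _) (yes _) (no _)  _    = ≤-refl
exchange-≤ (yes _) (no _)  (yes _) _    = ≤-refl
exchange-≤ (yes _) (no _)  (no _)  _    = ≤-refl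
exchange-≤ (no _)  (yes _) (yes _) _    = ≤-refl
exchange-≤ (no _)  (yes _) (no _)  _    = ≤-refl
exchange-≤ (no _)  (no _)  (yes _) _    = ≤-refl
exchange-≤ (no _)  (no _)  (no _)  _    = ≤-refl

module _ {R : Fin m → Fin m → Set} (R? : ∀ u v → Dec (R u v)) (R-sym : ∀ {u v} → R u v → R v u)
         {D : Subset m} (D-cover : Cover R D) (D-min : ∀ S → Cover R S → ∣ D ∣ ≤ ∣ S ∣) where

  module Enlarge {X : Fin m → Set} (X? : ∀ u → Dec (X u)) where

    W : Fin m → Set
    W u = ¬ X u × (∀ v → R u v → X v)

    W? : ∀ u → Dec (W u)
    W? u = ¬? (X? u) ×-dec all? (λ v → R? u v →-dec X? v)

    DX? : ∀ u → Dec (u ∈ D × (X u ⊎ W u))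
    DX? u = (u ∈? D) ×-dec (X? u ⊎-dec W? u)

    E? : ∀ u → Dec ((u ∈ D × ¬ W u) ⊎ (¬ (u ∈ D) × X u))
    E? u = ((u ∈? D) ×-dec ¬? (W? u)) ⊎-dec (¬? (u ∈? D) ×-dec X? u)

    -- A vertex of `D` is dropped only if it lies in `W`, and then all its neighbours lie in `X`.
    -- Such a neighbour is kept: outside `D` it is added, and inside `D` it cannot be in `W`, which
    -- is disjoint from `X`.
    E-cover : Cover R (comprehension E?)
    E-cover u v r with E? u | E? v
    ... | yes e | _     = inj₁ (∈-comprehension⁺ E? e)
    ... | no _  | yes e = inj₂ (∈-comprehension⁺ E? e)
    ... | no ¬e | no ¬f with u ∈? D | v ∈? D
    ... | no u∉ | no v∉ = contradiction (D-cover u v r) λ { (inj₁ u∈) → u∉ u∈ ; (inj₂ v∈) → v∉ v∈ }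
    ... | yes u∈ | no v∉ =
      contradiction (inj₁ (u∈ , λ { (_ , N⊆X) → ¬f (inj₂ (v∉ , N⊆X v r)) })) ¬e
    ... | no u∉ | yes v∈ =
      contradiction (inj₁ (v∈ , λ { (_ , N⊆X) → ¬e (inj₂ (u∉ , N⊆X u (R-sym r))) })) ¬f
    ... | yes u∈ | yes v∈ =
      contradiction (inj₁ (u∈ , λ { (u∉X , _) →
        ¬f (inj₁ (v∈ , λ { (_ , N⊆X) → u∉X (N⊆X u (R-sym r)) })) })) ¬e

    -- Adding |E| on both sides makes `exchange-≤` applicable; minimality then replaces |D| by |E|,
    -- which cancels.
    sum-DX≤sum-X : sum (ind ∘ DX?) ≤ sum (ind ∘ X?)
    sum-DX≤sum-X = +-cancelʳ-≤ (sum (ind ∘ E?)) _ _ (begin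
      sum (ind ∘ DX?) + sum (ind ∘ E?)        ≡⟨ ∑-distrib-+ (ind ∘ DX?) (ind ∘ E?) ⟨
      sum (λ u → ind (DX? u) + ind (E? u))
        ≤⟨ sum-mono-≤ (λ u → exchange-≤ (u ∈? D) (X? u) (W? u) proj₁) ⟩
      sum (λ u → ind (X? u) + ind (u ∈? D))   ≡⟨ ∑-distrib-+ (ind ∘ X?) (λ u → ind (u ∈? D)) ⟩
      sum (ind ∘ X?) + sum (λ u → ind (u ∈? D)) ≡⟨ cong (sum (ind ∘ X?) +_) (∣p∣≡sum D) ⟨
      sum (ind ∘ X?) + ∣ D ∣
        ≤⟨ +-monoʳ-≤ (sum (ind ∘ X?)) (≤-trans (D-min _ E-cover) (∣comprehension∣≤sum E?)) ⟩
      sum (ind ∘ X?) + sum (ind ∘ E?)         ∎)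
      where open ≤-Reasoning

  module _ {T : Fin k → Fin k → Set} {b : ℕ} (b-min : ∀ S → Cover T S → b ≤ ∣ S ∣)
           {C : Subset (m * k)}
           (C-cover : ∀ {u v x y} → R u v → T x y → combine u x ∈ C ⊎ combine v y ∈ C) where

    X? : (x : Fin k) (u : Fin m) → Dec (combine u x ∈ C)
    X? x u = combine u x ∈? C

    open module E x = Enlarge (X? x)

    M? : ∀ d x → Dec (combine d x ∈ C ⊎ W x d)
    M? d x = X? x d ⊎-dec W? x d

    -- If `T x y` holds and `C` contains neither (d,x) nor (d,y), then for each neighbour v of d the
    -- edge from (v,x) to (d,y) forces (v,x) into `C`. Hence d lies in `W x`.
    M-cover : ∀ {d} → Cover T (comprehension (M? d))
    M-cover {d} x y t with X? x d | X? y d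
    ... | yes p | _     = inj₁ (∈-comprehension⁺ (M? d) (inj₁ p))
    ... | no _  | yes q = inj₂ (∈-comprehension⁺ (M? d) (inj₁ q))
    ... | no p  | no q  = inj₁ (∈-comprehension⁺ (M? d) (inj₂ (p , N⊆X)))
      where
      N⊆X : ∀ v → R d v → combine v x ∈ C
      N⊆X v r with C-cover (R-sym r) t
      ... | inj₁ v∈ = v∈
      ... | inj₂ d∈ = contradiction d∈ q

    b≤row : ∀ d → ind (d ∈? D) * b ≤ sum (λ x → ind (DX? x d))
    b≤row d with d ∈? D
    ... | no _   = z≤n
    ... | yes _  = begin
      1 * b                     ≡⟨ *-identityˡ b ⟩
      b                         ≤⟨ b-min _ M-cover ⟩
      ∣ comprehension (M? d) ∣  ≤⟨ ∣comprehension∣≤sum (M? d) ⟩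
      -- For `d` in `D`, `DX? x d` evaluates as `M? d x` does, so this is already the row sum.
      sum (ind ∘ M? d)          ∎
      where open ≤-Reasoning

    cover-product : ∣ D ∣ * b ≤ ∣ C ∣
    cover-product = begin
      ∣ D ∣ * b                                    ≡⟨ cong (_* b) (∣p∣≡sum D) ⟩
      sum (λ d → ind (d ∈? D)) * b                 ≡⟨ *-distribʳ-sum b (λ d → ind (d ∈? D)) ⟩
      sum (λ d → ind (d ∈? D) * b)                 ≤⟨ sum-mono-≤ b≤row ⟩
      sum (λ d → sum (λ x → ind (DX? x d)))        ≡⟨ ∑-comm (λ d x → ind (DX? x d)) ⟩
      sum (λ x → sum (λ d → ind (DX? x d)))        ≤⟨ sum-mono-≤ sum-DX≤sum-X ⟩
      sum (λ x → sum (λ d → ind (X? x d)))         ≡⟨ ∑-comm (λ x d → ind (X? x d)) ⟩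
      sum (λ d → sum (λ x → ind (X? x d)))         ≡⟨ sum-combine m (λ p → ind (p ∈? C)) ⟨
      sum (λ p → ind (p ∈? C))                     ≡⟨ ∣p∣≡sum C ⟨
      ∣ C ∣                                        ∎
      where open ≤-Reasoning

-- Strong resolving sets as vertex covers

module _ {G : Graph} where

  _++_ : ∀ {u v w k l} → Walk G u v k → Walk G v w l → Walk G u w (k + l)
  here     ++ q = q
  step a p ++ q = step a (p ++ q)

  snoc : ∀ {u v w k} → Walk G u v k → Adj G v w → Walk G u w (suc k)
  snoc here       b = step b here
  snoc (step a p) b = step a (snoc p b)

  reverse : ∀ {u v k} → Walk G u v k → Walk G v u k
  reverse here       = here
  reverse (step a p) = snoc (reverse p) (Graph.sym G a)

  Dist-sym : ∀ {u v k} → Dist G u v k → Dist G v u k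
  Dist-sym (p , min) = reverse p , λ m m<k q → min m m<k (reverse q)

  Dist-≤ : ∀ {u v k l} → Dist G u v k → Walk G u v l → k ≤ l
  Dist-≤ (_ , min) q = ≮⇒≥ λ l<k → min _ l<k q

  Dist-prefix : ∀ {u v w k l} → Walk G u v k → Walk G v w l → Dist G u w (k + l) → Dist G u v k
  Dist-prefix {l = l} p q (_ , min) = p , λ m m<k r → min (m + l) (+-monoˡ-< l m<k) (r ++ q)

  Dist-suffix : ∀ {u v w k l} → Walk G u v k → Walk G v w l → Dist G u w (k + l) → Dist G v w l
  Dist-suffix {k = k} p q (_ , min) = q , λ m m<l r → min (k + m) (+-monoʳ-< k m<l) (p ++ r)

-- Distances occur only negatively, so that no distance function has to be
-- extracted from the undecidable adjacency relation.
MaxDistant : (G : Graph) → V G → V G → Set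
MaxDistant G u v = ∀ {w k} → Walk G u v k → Adj G v w → ¬ Dist G u w (suc k)

MMD : (G : Graph) → V G → V G → Set
MMD G u v = u ≢ v × MaxDistant G u v × MaxDistant G v u

MMD-sym : (G : Graph) → ∀ {u v} → MMD G u v → MMD G v u
MMD-sym G (u≢v , far , far′) = u≢v ∘ ≡-sym , far′ , far

module _ (G : Graph) where

  -- A geodesic from u that continued past v would next visit a neighbour of v farther from u.
  interval-from-MaxDistant : ∀ {u v w} → MaxDistant G u v → InInterval G u w v → w ≡ v
  interval-from-MaxDistant far (a , _ , p , here , _) = refl
  interval-from-MaxDistant {u} far (a , suc b , p , step e q , d) =
    ⊥-elim (far p e (Dist-prefix (snoc p e) q (subst (Dist G u _) (+-suc a b) d)))

  resolving⇒cover : ∀ {S} → StrongResolvingSet G S → Cover (MMD G) S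
  resolving⇒cover {S} res u v (u≢v , far , far′) with res u v u≢v
  ... | w , w∈S , inj₁ v∈I = inj₂ (subst (_∈ S) (interval-from-MaxDistant far v∈I) w∈S)
  ... | w , w∈S , inj₂ u∈I = inj₁ (subst (_∈ S) (interval-from-MaxDistant far′ u∈I) w∈S)

  -- The walks chosen by `conn` are finitely many, so their lengths have a common bound, which need
  -- not be the exact diameter.
  diameter-bound : Connected G → ∃ λ B → ∀ {u v k} → Dist G u v k → k ≤ B
  diameter-bound conn with Fin-bounded (λ u → proj₁ (Fin-bounded (λ v → proj₁ (conn u v))))
  ... | B , ecc≤B = B , λ {u} {v} d →
    ≤-trans (Dist-≤ d (proj₂ (conn u v))) (≤-trans (proj₂ (Fin-bounded _) v) (ecc≤B u))

  module _ (conn : Connected G) {S : Subset (n G)} (cover : Cover (MMD G) S) where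

    -- The fuel f makes up the difference between the diameter and the
    -- geodesic u′ – u – v – v′, which is extended at either end.
    resolve : ∀ {u v} → u ≢ v → ¬ (∃ λ w → w ∈ S × StronglyResolves G w u v) →
      ∀ f {u′ v′ i d j} → Walk G u′ u i → Walk G u v d → Walk G v v′ j →
      Dist G u′ v′ (i + (d + j)) → ¬ (proj₁ (diameter-bound conn) < f + (i + (d + j)))
    resolve u≢v unres zero p q r dist B< = <⇒≱ B< (proj₂ (diameter-bound conn) dist)
    resolve {u} {v} u≢v unres (suc f) {u′} {v′} {i} {d} {j} p q r dist B<
      = refute (cover u′ v′ (u′≢v′ , far , far′))
      where
      L = i + (d + j)

      u′≢v′ : u′ ≢ v′
      u′≢v′ refl = u≢v (trivial q (m+n≡0⇒m≡0 d (m+n≡0⇒n≡0 i (n≤0⇒n≡0 (Dist-≤ dist here)))))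
        where
        trivial : ∀ {x y k} → Walk G x y k → k ≡ 0 → x ≡ y
        trivial here _ = refl

      -- The geodesic visits u′, u, v, v′ in this order, so either end strongly resolves u and v.
      refute : ¬ (u′ ∈ S ⊎ v′ ∈ S)
      refute (inj₁ u′∈S) = unres (u′ , u′∈S , inj₂ (d , i , reverse q , reverse p ,
        Dist-sym (subst (λ k → Dist G u′ v k) (+-comm i d)
          (Dist-prefix (p ++ q) r (subst (Dist G u′ v′) (≡-sym (+-assoc i d j)) dist)))))
      refute (inj₂ v′∈S) = unres (v′ , v′∈S , inj₁ (d , j , q , r , Dist-suffix p (q ++ r) dist))

      -- Here k = L: minimality of L gives L ≤ k, and prolonging the geodesic by the edge to z gives
      -- k ≤ L.
      farther : ∀ {x y z k} → Dist G x y L → Walk G x y k → Adj G y z → Dist G x z (suc k) →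
                Dist G x z (suc L)
      farther {x} {z = z} dxy s e dxz =
        subst (Dist G x z ∘ suc) (≤-antisym (≤-pred (Dist-≤ dxz (snoc (proj₁ dxy) e))) (Dist-≤ dxy s)) dxz

      B<′ : proj₁ (diameter-bound conn) < f + suc L
      B<′ = subst (proj₁ (diameter-bound conn) <_) (≡-sym (+-suc f L)) B<

      far : MaxDistant G u′ v′
      far {w} s e dw = resolve u≢v unres f p q (snoc r e)
        (subst (Dist G u′ w) (≡-sym eq) (farther dist s e dw))
        (subst (λ l → proj₁ (diameter-bound conn) < f + l) (≡-sym eq) B<′)
        where
        eq : i + (d + suc j) ≡ suc L
        eq = ≡-trans (cong (i +_) (+-suc d j)) (+-suc i (d + j))

      far′ : MaxDistant G v′ u′
      far′ s e dw = resolve u≢v unres f (step (Graph.sym G e) p) q r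
        (Dist-sym (farther (Dist-sym dist) s e dw)) B<′

    cover⇒¬¬resolving : ¬ ¬ StrongResolvingSet G S
    cover⇒¬¬resolving = ¬¬-∀Fin λ u → ¬¬-∀Fin λ v → resolved u v
      where
      resolved : ∀ u v → ¬ ¬ (u ≢ v → ∃ λ w → w ∈ S × StronglyResolves G w u v)
      resolved u v unres with u ≟ᶠ v
      ... | yes u≡v = unres (λ u≢v → contradiction u≡v u≢v)
      ... | no u≢v  = ¬¬-least (Walk G u v) _ (proj₂ (conn u v)) λ { (k , q , min) →
        -- Both extensions start empty. With fuel one above the bound, exhausting it would yield a
        -- geodesic longer than the bound.
        resolve u≢v (λ res → unres (λ _ → res)) (suc (proj₁ (diameter-bound conn))) here q here
          (subst (Dist G u v) (≡-sym (+-identityʳ k)) (q , min)) (s≤s (m≤m+n _ _)) }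

  -- A cover is only known to be resolving up to double negation; this suffices because `≤` is
  -- decidable.
  dim≤cover : Connected G → ∀ {k} → IsStrongMetricDim G k → ∀ S → Cover (MMD G) S → k ≤ ∣ S ∣
  dim≤cover conn {k} (_ , min) S cover =
    decidable-stable (k ≤? ∣ S ∣) (¬¬-map (min S) (cover⇒¬¬resolving conn cover))

-- Mutually maximally distant vertices of a Cartesian product

module _ (G H : Graph) where

  π₁ : V (G □ H) → V G
  π₁ p = proj₁ (remQuot {n G} (n H) p)

  π₂ : V (G □ H) → V H
  π₂ p = proj₂ (remQuot {n G} (n H) p)

  π₁-combine : ∀ (u : V G) (x : V H) → π₁ (combine u x) ≡ u
  π₁-combine u x = cong proj₁ (remQuot-combine u x)

  π₂-combine : ∀ (u : V G) (x : V H) → π₂ (combine u x) ≡ x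
  π₂-combine u x = cong proj₂ (remQuot-combine u x)

  -- Each step moves exactly one coordinate. Together with `walk-lift` this encodes that distances
  -- in the product add up.
  walk-project : ∀ {p q k} → Walk (G □ H) p q k →
    ∃ λ i → ∃ λ j → i + j ≡ k × Walk G (π₁ p) (π₁ q) i × Walk H (π₂ p) (π₂ q) j
  walk-project here = 0 , 0 , refl , here , here
  walk-project {q = q} (step (inj₁ (e , a)) w) with walk-project w
  ... | i , j , refl , g , h =
    i , suc j , +-suc i j , subst (λ x → Walk G x (π₁ q) i) (≡-sym e) g , step a h
  walk-project {q = q} (step (inj₂ (e , a)) w) with walk-project w
  ... | i , j , refl , g , h =
    suc i , j , refl , step a g , subst (λ x → Walk H x (π₂ q) j) (≡-sym e) h

  walk-combine : ∀ {u v x y i j} → Walk G u v i → Walk H x y j →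
    Walk (G □ H) (combine u x) (combine v y) (i + j)
  walk-combine here here = here
  walk-combine {u} {x = x} here (step {v = z} a h) = step adj (walk-combine here h)
    where
    adj : Adj (G □ H) (combine u x) (combine u z)
    adj = inj₁ (≡-trans (π₁-combine u x) (≡-sym (π₁-combine u z)) ,
      subst₂ (Adj H) (≡-sym (π₂-combine u x)) (≡-sym (π₂-combine u z)) a)
  walk-combine {u} {x = x} (step {v = w} a g) h = step adj (walk-combine g h)
    where
    adj : Adj (G □ H) (combine u x) (combine w x)
    adj = inj₂ (≡-trans (π₂-combine u x) (≡-sym (π₂-combine w x)) ,
      subst₂ (Adj G) (≡-sym (π₁-combine u x)) (≡-sym (π₁-combine w x)) a)

  walk-lift : ∀ p q {i j} → Walk G (π₁ p) (π₁ q) i → Walk H (π₂ p) (π₂ q) j →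
    Walk (G □ H) p q (i + j)
  walk-lift p q {i} {j} g h =
    subst₂ (λ x y → Walk (G □ H) x y (i + j)) (combine-remQuot {n G} (n H) p)
      (combine-remQuot {n G} (n H) q) (walk-combine g h)

  -- The last edge moves one coordinate. A shortcut for the prolonged walk in that factor,
  -- recombined with the other projection, would beat the distance from p to r; so that factor would
  -- already violate maximality.
  MaxDistant-□ : ∀ p q → MaxDistant G (π₁ p) (π₁ q) → MaxDistant H (π₂ p) (π₂ q) →
    MaxDistant (G □ H) p q
  MaxDistant-□ p q farG farH {r} s adj (_ , min) with walk-project s | adj
  ... | i , j , refl , g , h | inj₁ (e , a) = farH h a (snoc h a , λ m m<j h′ →
    min (i + m) (subst (i + m <_) (+-suc i j) (+-monoʳ-< i m<j))
      (walk-lift p r (subst (λ x → Walk G (π₁ p) x i) e g) h′))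
  ... | i , j , refl , g , h | inj₂ (e , a) = farG g a (snoc g a , λ m m<i g′ →
    min (m + j) (+-monoˡ-< j m<i)
      (walk-lift p r g′ (subst (λ x → Walk H (π₂ p) x j) e h)))

  MaxDistant-combine : ∀ {u v x y} → MaxDistant G u v → MaxDistant H x y →
    MaxDistant (G □ H) (combine u x) (combine v y)
  MaxDistant-combine {u} {v} {x} {y} farG farH =
    MaxDistant-□ (combine u x) (combine v y)
      (subst₂ (MaxDistant G) (≡-sym (π₁-combine u x)) (≡-sym (π₁-combine v y)) farG)
      (subst₂ (MaxDistant H) (≡-sym (π₂-combine u x)) (≡-sym (π₂-combine v y)) farH)

  MMD-combine : ∀ {u v x y} → MMD G u v → MMD H x y → MMD (G □ H) (combine u x) (combine v y)
  MMD-combine (u≢v , farG , farG′) (_ , farH , farH′) =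
    u≢v ∘ combine-injectiveˡ _ _ _ _ ,
    MaxDistant-combine farG farH , MaxDistant-combine farG′ farH′

theorem26 : (G H : Graph) → Connected G → Connected H →
    ∀ (a b c : ℕ) → IsStrongMetricDim G a → IsStrongMetricDim H b →
    IsStrongMetricDim (G □ H) c → a * b ≤ c
theorem26 G H connG connH a b c dimG@((D , D-res , refl) , _) dimH ((C , C-res , refl) , _) =
  -- The goal is stable, so the finite table of decisions for `MMD G` may be assumed.
  decidable-stable (a * b ≤? c) (¬¬-map bound (¬¬-∀Fin λ u → ¬¬-∀Fin λ v → ¬¬-excluded-middle))
  where
  bound : (∀ u v → Dec (MMD G u v)) → a * b ≤ c
  -- A minimum strong resolving set `D` is also a minimum vertex cover of `MMD G`.
  bound MMD? = cover-product MMD? (MMD-sym G) (resolving⇒cover G D-res) (dim≤cover G connG dimG)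
    (dim≤cover H connH dimH)
    (λ r t → resolving⇒cover (G □ H) C-res _ _ (MMD-combine G H r t))
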